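{- Let $n\ge 2$ and $\mathbf{y}=(y_1,y_2,\dots,y_n)\in\mathbb{N}^n$. If $\mathbf{y}$ is minimally invariant, i.e. $\mathsf{PA}^{\mathrm{inv}}_n(\mathbf{y})=\{(1,1,\dots,1)\}$, then $$y_1<\min(y_2,y_3,\dots,y_n)\quad\text{and}\quad y_2\neq\sum_{j\in[n]\setminus\{2\}}y_j.$$
   Context: $\mathbb{N}=\{1,2,3,\dots\}$ and $[n]=\{1,\dots,n\}$. Let $\mathbf{y}=(y_1,\dots,y_n)\in\mathbb{N}^n$ and $m=\sum_{i=1}^n y_i$. Consider a one-way street with $m$ parking spots numbered $1,\dots,m$ and $n$ cars entering in order $1,2,\dots,n$, where car $i$ has length $y_i$ and prefers spot $x_i\in[m]$. Car $i$ drives to spot $x_i$ and parks in $x_i,x_i+1,\dots,x_i+y_i-1$ if these spots exist and are all unoccupied; otherwise it parks in the next $y_i$ contiguous available spots, i.e. it occupies $s,s+1,\dots,s+y_i-1$ for the smallest $s\ge x_i$ such that $s+y_i-1\le m$ and all these spots are unoccupied; if no such $s$ exists, parking fails. The vector $\mathbf{x}=(x_1,\dots,x_n)\in[m]^n$ is a parking assortment for $\mathbf{y}$ if all cars can park; the set of these is $\mathsf{PA}_n(\mathbf{y})$. A parking assortment $\mathbf{x}$ is (permutation) invariant if every permutation of its entries is also in $\mathsf{PA}_n(\mathbf{y})$; $\mathsf{PA}^{\mathrm{inv}}_n(\mathbf{y})$ is the set of invariant parking assortments for $\mathbf{y}$. -}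

module Defs where

open import Data.Fin using (Fin; _<_)
open import Data.Fin.Permutation using (Permutation′; _⟨$⟩ʳ_)
open import Data.Nat using (ℕ; _+_; _≤_) renaming (_<_ to _<ℕ_)
open import Data.Product using (_×_; ∃-syntax)
open import Data.Vec using (Vec; lookup; replicate; sum; tabulate)
open import Data.Vec.Relation.Unary.All using (All)
open import Level using (0ℓ)
open import Relation.Nullary using (¬_)
open import Relation.Unary using (Pred; ｛_｝; _≐_)

private
  variable
    n : ℕ

-- Cars are indexed by Fin n (so car 1 is index 0), while spots are the
-- natural numbers 1, …, m with m = sum y.  In what follows s records the
-- first spot taken by each car, so that car j fills the spots p with
-- lookup s j ≤ p < lookup s j + lookup y j.

OccupiedBefore : (y s : Vec ℕ n) → Fin n → ℕ → Set
OccupiedBefore y s i p =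
  ∃[ j ] j < i × lookup s j ≤ p × p <ℕ lookup s j + lookup y j

-- Every spot of the block t, …, t + yᵢ - 1 is at most m and is available
-- when car i enters.
Fits : (y s : Vec ℕ n) → Fin n → ℕ → Set
Fits y s i t =
  ∀ p → t ≤ p → p <ℕ t + lookup y i → p ≤ sum y × ¬ OccupiedBefore y s i p

record ParksAt (y x s : Vec ℕ n) (i : Fin n) : Set where
  field
    forward : lookup x i ≤ lookup s i
    fits    : Fits y s i (lookup s i)
    first   : ∀ t → lookup x i ≤ t → Fits y s i t → lookup s i ≤ t

PA : Vec ℕ n → Pred (Vec ℕ n) 0ℓ
PA y x =
  All (λ a → 1 ≤ a × a ≤ sum y) x × (∃[ s ] ∀ i → ParksAt y x s i)

permute : Permutation′ n → Vec ℕ n → Vec ℕ n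
permute π x = tabulate (λ i → lookup x (π ⟨$⟩ʳ i))

PAinv : Vec ℕ n → Pred (Vec ℕ n) 0ℓ
PAinv y x = PA y x × (∀ π → PA y (permute π x))

MinimallyInvariant : Vec ℕ n → Set
MinimallyInvariant {n} y = PAinv y ≐ ｛ replicate n 1 ｝

{-# OPTIONS --safe #-}

-- The candidates for a nontrivial invariant assortment are the vectors with a
-- single entry 1 + g different from 1.  If g is the minimum of y₂, …, yₙ and
-- g ≤ y₁, then the entry 1 + g has an effect only on car 1, which leaves a gap
-- of length g; the first later car of length g fills it, since all cars before it
-- are too long for the gap.  If y₂ = g is the sum of the other lengths, then car 1
-- leaves a gap that car 2 fills, whereas car 2 takes the right half of the street
-- and leaves the left half for the others.
module Submission where

open import Defs
open import Data.Fin using (Fin; zero; suc)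
open import Data.Fin.Patterns using (1F)
open import Data.Fin.Permutation using (Permutation′; _⟨$⟩ʳ_; _⟨$⟩ˡ_; inverseʳ; inverseˡ)
open import Data.Fin.Properties using () renaming (_≟_ to _≟ᶠ_)
open import Data.Nat using (ℕ; zero; suc; _+_; _≤_; _<_; _⊓_; NonZero; z≤n; s≤s; _≤?_; _<?_; >-nonZero⁻¹)
open import Data.Nat.Properties
open import Data.Product using (_×_; _,_; proj₂; ∃-syntax)
open import Data.Sum using (inj₁; inj₂)
open import Data.Unit using (⊤; tt)
open import Data.Vec using (Vec; []; _∷_; head; tail; lookup; removeAt; foldr₁; sum; replicate; _[_]≔_)
open import Data.Vec.Properties using (lookup∘update; lookup∘update′; lookup-replicate; tabulate∘lookup; tabulate-cong)
open import Data.Vec.Relation.Unary.All as All using (All; []; _∷_)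
open import Function using (_∘_)
open import Level using (0ℓ)
open import Relation.Binary.PropositionalEquality using (_≡_; _≢_; refl; sym; trans; cong; subst)
open import Relation.Nullary using (¬_; yes; no; contradiction)
open import Relation.Unary using (Pred; _∪_; _≐_; ∅)

private
  variable
    n a b g m x y s : ℕ
    P Q : Pred ℕ 0ℓ

-- Parking one car at a time

Block : ℕ → ℕ → Pred ℕ 0ℓ
Block s y p = s ≤ p × p < s + y

-- The occupied spots are an arbitrary predicate, so that the state of the street can be threaded
-- through a recursion over the cars. With `OccupiedBefore` as `P` the fields become those of
-- `ParksAt`.
record Parks (m : ℕ) (P : Pred ℕ 0ℓ) (y x s : ℕ) : Set where
  field
    forward : x ≤ s
    fits    : ∀ p → s ≤ p → p < s + y → p ≤ m × ¬ P p
    first   : ∀ t → x ≤ t → (∀ p → t ≤ p → p < t + y → p ≤ m × ¬ P p) → s ≤ t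

parks-resp-≐ : P ≐ Q → Parks m P y x s → Parks m Q y x s
parks-resp-≐ (P⊆Q , Q⊆P) park = record
  { forward = forward
  ; fits    = λ p l u → let p≤m , free = fits p l u in p≤m , free ∘ Q⊆P
  ; first   = λ t x≤t fit → first t x≤t
      (λ p l u → let p≤m , free = fit p l u in p≤m , free ∘ P⊆Q)
  }
  where open Parks park

parks : x ≤ s → s + y ≤ suc m →
        (∀ {p} → Block s y p → ¬ P p) →
        (∀ {t} → x ≤ t → t < s → ∃[ p ] Block t y p × P p) →
        Parks m P y x s
parks x≤s end free blocked = record
  { forward = x≤s
  ; fits    = λ p l u → ≤-pred (≤-trans u end) , free (l , u)
  ; first   = λ t x≤t fit → ≮⇒≥ λ t<s →
      let p , (l , u) , Pp = blocked x≤t t<s in proj₂ (fit p l u) Pp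
  }

-- The predicate holds at the spots that are occupied before the listed cars.
AllPark : ℕ → Pred ℕ 0ℓ → Vec ℕ n → Vec ℕ n → Set
AllPark m P []       []       = ⊤
AllPark m P (y ∷ ys) (x ∷ xs) =
  ∃[ s ] Parks m P y x s × AllPark m (P ∪ Block s y) ys xs

-- The block of the first car belongs to the predicate in the recursive call, but is the case
-- `j = zero` of `OccupiedBefore` in the result. The conversions only move it across the union.
allPark-positions : ∀ (ys xs : Vec ℕ n) → AllPark m P ys xs →
  ∃[ ss ] ∀ i → Parks m (P ∪ OccupiedBefore ys ss i) (lookup ys i) (lookup xs i) (lookup ss i)
allPark-positions [] [] _ = [] , λ ()
allPark-positions {P = P} (y ∷ ys) (x ∷ xs) (s , park , rest) =
  let ss , parkss = allPark-positions ys xs rest in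
  s ∷ ss , λ where
    zero    → parks-resp-≐ (inj₁ , λ { (inj₁ Pp) → Pp ; (inj₂ (_ , () , _)) }) park
    (suc i) → parks-resp-≐
      ( (λ { (inj₁ (inj₁ Pp))          → inj₁ Pp
           ; (inj₁ (inj₂ blk))         → inj₂ (zero , s≤s z≤n , blk)
           ; (inj₂ (j , j<i , blk))    → inj₂ (suc j , s≤s j<i , blk) })
      , (λ { (inj₁ Pp)                     → inj₁ (inj₁ Pp)
           ; (inj₂ (zero , _ , blk))       → inj₁ (inj₂ blk)
           ; (inj₂ (suc j , s≤s j<i , blk)) → inj₂ (j , j<i , blk) }) )
      (parkss i)

allPark⇒PA : ∀ (ys xs : Vec ℕ n) → All (λ a → 1 ≤ a × a ≤ sum ys) xs →
             AllPark (sum ys) ∅ ys xs → PA ys xs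
allPark⇒PA ys xs bounds park =
  let ss , parkss = allPark-positions ys xs park in
  bounds , ss , λ i →
    let open Parks (parks-resp-≐ ((λ { (inj₁ ()) ; (inj₂ o) → o }) , inj₂) (parkss i)) in
    record { forward = forward ; fits = fits ; first = first }

-- Filling the street without gaps

-- No car prefers a spot beyond the one it gets when the cars are lined up
-- without gaps from spot b onwards.
Early : ℕ → Vec ℕ n → Vec ℕ n → Set
Early b []       []       = ⊤
Early b (y ∷ ys) (x ∷ xs) = (1 ≤ x × x ≤ b) × Early (b + y) ys xs

early-≤ : ∀ (ys : Vec ℕ n) {xs} → All (λ x → 1 ≤ x × x ≤ b) xs → Early b ys xs
early-≤ []       []                       = tt
early-≤ (y ∷ ys) ((1≤x , x≤b) ∷ bounds) =
  (1≤x , x≤b) , early-≤ ys (All.map (λ (1≤x , x≤b) → 1≤x , ≤-trans x≤b (m≤m+n _ y)) bounds)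

-- All spots below `b` are full, so a car that prefers one of them, or `b` itself, is pushed to
-- exactly `b`; then all spots below `b + y` are full. Spots from `b + sum ys` on may be taken
-- already, which `PA-gapAfterFirst` exploits.
allPark-contiguous : ∀ {ys xs : Vec ℕ n} → All NonZero ys → Early b ys xs →
  b + sum ys ≤ suc m →
  (∀ {p} → 1 ≤ p → p < b → P p) →
  (∀ {p} → b ≤ p → p < b + sum ys → ¬ P p) →
  AllPark m P ys xs
allPark-contiguous {xs = []} [] _ _ _ _ = tt
allPark-contiguous {b = b} {ys = y ∷ ys} {xs = x ∷ xs} (y≢0 ∷ ys≢0) ((1≤x , x≤b) , early) end occ free =
  b ,
  parks x≤b (≤-trans (+-monoʳ-≤ b (m≤m+n y _)) end)
    (λ (l , u) → free l (≤-trans u (+-monoʳ-≤ b (m≤m+n y _))))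
    (λ {t} x≤t t<b → t , (≤-refl , m<m+n t (>-nonZero⁻¹ y {{y≢0}})) , occ (≤-trans 1≤x x≤t) t<b) ,
  allPark-contiguous ys≢0 early
    (≤-trans (≤-reflexive (+-assoc b y _)) end)
    occ′
    (λ l u → λ where
      (inj₁ Pp)        → free (≤-trans (m≤m+n b y) l) (≤-trans u (≤-reflexive (+-assoc b y _))) Pp
      (inj₂ (_ , p<))  → <⇒≱ p< l)
  where
  occ′ : ∀ {p} → 1 ≤ p → p < b + y → _
  occ′ {p} 1≤p p<b+y with p <? b
  ... | yes p<b = inj₁ (occ 1≤p p<b)
  ... | no  p≮b = inj₂ (≮⇒≥ p≮b , p<b+y)

-- A gap of length g at the left end

data FirstFits (g : ℕ) : Vec ℕ n → Set where
  here  : ∀ {ys : Vec ℕ n} → FirstFits g (g ∷ ys)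
  there : ∀ {ys : Vec ℕ n} → g < y → FirstFits g ys → FirstFits g (y ∷ ys)

firstFits-min : ∀ (ys : Vec ℕ (suc n)) → FirstFits (foldr₁ _⊓_ ys) ys
firstFits-min (y ∷ []) = here
-- Ties go to `here`, because `there` demands a strictly longer car.
firstFits-min (y ∷ ys@(_ ∷ _)) with y ≤? foldr₁ _⊓_ ys
... | yes y≤μ rewrite m≤n⇒m⊓n≡m y≤μ = here
... | no  y≰μ rewrite m≥n⇒m⊓n≡n (≰⇒≥ y≰μ) = there (≰⇒> y≰μ) (firstFits-min ys)

firstFits⇒≤sum : ∀ {ys : Vec ℕ n} → FirstFits g ys → g ≤ sum ys
firstFits⇒≤sum here = m≤m+n _ _
firstFits⇒≤sum {ys = y ∷ _} (there _ fit) = ≤-trans (firstFits⇒≤sum fit) (m≤n+m _ y)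

firstFits⇒nonZero : ∀ {ys : Vec ℕ n} → All NonZero ys → FirstFits g ys → NonZero g
firstFits⇒nonZero (g≢0 ∷ _) here = g≢0
firstFits⇒nonZero (_ ∷ ys≢0) (there _ fit) = firstFits⇒nonZero ys≢0 fit

replicate-1-bounds : ∀ n → 1 ≤ b → All (λ x → 1 ≤ x × x ≤ b) (replicate n 1)
replicate-1-bounds zero    1≤b = []
replicate-1-bounds (suc n) 1≤b = (≤-refl , 1≤b) ∷ replicate-1-bounds n 1≤b

update-1-bounds : ∀ (i : Fin n) → 1 ≤ a → a ≤ b →
                  All (λ x → 1 ≤ x × x ≤ b) (replicate n 1 [ i ]≔ a)
update-1-bounds {n = suc n} zero    1≤a a≤b = (1≤a , a≤b) ∷ replicate-1-bounds n (≤-trans 1≤a a≤b)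
update-1-bounds {n = suc n} (suc i) 1≤a a≤b = (≤-refl , ≤-trans 1≤a a≤b) ∷ update-1-bounds i 1≤a a≤b

-- The longer cars queue up from `b` on until the car of length `g` takes the gap exactly; after
-- that the street is full up to the queue's end. The end bound has slack `g` because that one car
-- does not join the queue.
allPark-fillGap : ∀ {ys : Vec ℕ n} → All NonZero ys → FirstFits g ys →
  suc g < b →
  b + sum ys ≤ suc m + g →
  (∀ {p} → p ≤ g → ¬ P p) →
  (∀ {p} → g < p → p < b → P p) →
  (∀ {p} → b ≤ p → ¬ P p) →
  AllPark m P ys (replicate n 1)
allPark-fillGap {n = suc n} {g = g} {b = b} {m = m} {P = P} {ys = .g ∷ ys} (_ ∷ ys≢0) here 1+g<b end gap occ free =
  1 ,
  parks ≤-refl (≤-trans g<b (m+n≤o⇒m≤o b end′))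
    (λ { (_ , s≤s p≤g) → gap p≤g })
    (λ { (s≤s _) (s≤s ()) }) ,
  allPark-contiguous ys≢0 (early-≤ ys (replicate-1-bounds n (≤-trans (s≤s z≤n) g<b))) end′
    occ′
    (λ b≤p _ → λ where
      (inj₁ Pp)       → free b≤p Pp
      (inj₂ (_ , p<)) → <⇒≱ p< (≤-trans g<b b≤p))
  where
  g<b : g < b
  g<b = <⇒≤ 1+g<b
  end′ : b + sum ys ≤ suc m
  end′ = +-cancelʳ-≤ g _ _ (≤-trans (≤-reflexive (trans (+-assoc b _ g) (cong (b +_) (+-comm _ g)))) end)
  occ′ : ∀ {p} → 1 ≤ p → p < b → (P ∪ Block 1 g) p
  occ′ {p} 1≤p p<b with p ≤? g
  ... | yes p≤g = inj₂ (1≤p , s≤s p≤g)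
  ... | no  p≰g = inj₁ (occ (≰⇒> p≰g) p<b)
allPark-fillGap {n = suc n} {g = g} {b = b} {m = m} {P = P} {ys = y ∷ ys} (y≢0 ∷ ys≢0) (there g<y fit) 1+g<b end gap occ free =
  b ,
  parks (≤-trans (s≤s z≤n) g<b)
    -- The car of length `g` is still to come, so the remaining lengths add up to at least `g` and
    -- absorb the slack.
    (+-cancelʳ-≤ g _ _ (≤-trans (+-monoʳ-≤ (b + y) (firstFits⇒≤sum fit)) end′))
    (λ (l , _) → free l)
    blocked ,
  allPark-fillGap ys≢0 fit (≤-trans 1+g<b (m≤m+n b y)) end′
    (λ p≤g → λ where
      (inj₁ Pp)      → gap p≤g Pp
      (inj₂ (l , _)) → <⇒≱ g<b (≤-trans l p≤g))
    occ′
    (λ l → λ where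
      (inj₁ Pp)       → free (≤-trans (m≤m+n b y) l) Pp
      (inj₂ (_ , p<)) → <⇒≱ p< l)
  where
  g<b : g < b
  g<b = <⇒≤ 1+g<b
  end′ : b + y + sum ys ≤ suc m + g
  end′ = ≤-trans (≤-reflexive (+-assoc b y _)) end
  -- A car that starts in the gap would have to use the spot g + 1.
  blocked : ∀ {t} → 1 ≤ t → t < b → ∃[ p ] Block t y p × P p
  blocked {t} 1≤t t<b with t ≤? g
  ... | yes t≤g = suc g , (m≤n⇒m≤1+n t≤g , +-mono-≤ 1≤t g<y) , occ ≤-refl 1+g<b
  ... | no  t≰g = t , (≤-refl , m<m+n t (>-nonZero⁻¹ y {{y≢0}})) , occ (≰⇒> t≰g) t<b
  occ′ : ∀ {p} → g < p → p < b + y → (P ∪ Block b y) p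
  occ′ {p} g<p p<b+y with p <? b
  ... | yes p<b = inj₁ (occ g<p p<b)
  ... | no  p≮b = inj₂ (≮⇒≥ p≮b , p<b+y)

-- Reducing invariance to the position of one entry

permute-update : ∀ (π : Permutation′ n) (i : Fin n) a →
                 permute π (replicate n 1 [ i ]≔ a) ≡ replicate n 1 [ π ⟨$⟩ˡ i ]≔ a
permute-update {n} π i a = trans (tabulate-cong entry) (tabulate∘lookup _)
  where
  entry : ∀ j → lookup (replicate n 1 [ i ]≔ a) (π ⟨$⟩ʳ j) ≡ lookup (replicate n 1 [ π ⟨$⟩ˡ i ]≔ a) j
  entry j with j ≟ᶠ π ⟨$⟩ˡ i
  ... | yes refl rewrite inverseʳ π {i} =
    trans (lookup∘update i (replicate n 1) a) (sym (lookup∘update (π ⟨$⟩ˡ i) (replicate n 1) a))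
  ... | no j≢ = trans
    (trans (lookup∘update′ (λ eq → j≢ (trans (sym (inverseˡ π)) (cong (π ⟨$⟩ˡ_) eq))) (replicate n 1) a)
           (lookup-replicate (π ⟨$⟩ʳ j) 1))
    (sym (trans (lookup∘update′ j≢ (replicate n 1) a) (lookup-replicate j 1)))

-- A permutation can only move the exceptional entry, namely to the preimage of its index, so the n
-- positions exhaust all rearrangements.
update-invariant : ∀ {ys : Vec ℕ n} (k : Fin n) →
  (∀ i → PA ys (replicate n 1 [ i ]≔ a)) → PAinv ys (replicate n 1 [ k ]≔ a)
update-invariant {a = a} {ys = ys} k pa =
  pa k , λ π → subst (PA ys) (sym (permute-update π k a)) (pa (π ⟨$⟩ˡ k))

-- The two candidates

PA-contiguous : ∀ (ys xs : Vec ℕ n) → All NonZero ys → Early 1 ys xs →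
  All (λ x → 1 ≤ x × x ≤ sum ys) xs → PA ys xs
PA-contiguous ys xs ys≢0 early bounds =
  allPark⇒PA ys xs bounds
    (allPark-contiguous ys≢0 early ≤-refl (λ l u → contradiction l (<⇒≱ u)) (λ _ _ ()))

PA-gapBeforeFirst : ∀ {ys : Vec ℕ n} → NonZero y → All NonZero ys → FirstFits g ys →
  PA (y ∷ ys) (replicate (suc n) 1 [ zero ]≔ suc g)
PA-gapBeforeFirst {y = y} {g = g} {ys = ys} y≢0 ys≢0 fit =
  allPark⇒PA (y ∷ ys) _ (update-1-bounds zero (s≤s z≤n) (+-mono-≤ 1≤y g≤))
  ( suc g
  , parks ≤-refl (s≤s (≤-trans (≤-reflexive (+-comm g y)) (+-monoʳ-≤ y g≤))) (λ _ ())
      (λ l u → contradiction l (<⇒≱ u))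
  , allPark-fillGap ys≢0 fit
      (m<m+n (suc g) 1≤y)
      (≤-reflexive (cong suc (trans (+-assoc g y _) (+-comm g _))))
      (λ { p≤g (inj₂ (l , _)) → <⇒≱ l p≤g ; _ (inj₁ ()) })
      (λ l u → inj₂ (l , u))
      (λ { l (inj₂ (_ , u)) → <⇒≱ u l ; _ (inj₁ ()) }) )
  where
  1≤y : 1 ≤ y
  1≤y = >-nonZero⁻¹ y {{y≢0}}
  g≤ : g ≤ sum ys
  g≤ = firstFits⇒≤sum fit

PA-gapAfterFirst : ∀ {ys : Vec ℕ n} → All NonZero ys → NonZero y →
  let z = y + sum ys in
  PA (y ∷ z ∷ ys) (replicate (suc (suc n)) 1 [ 1F ]≔ suc z)
PA-gapAfterFirst {n = n} {y = y} {ys = ys} ys≢0 y≢0 =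
  allPark⇒PA (y ∷ z ∷ ys) _ (update-1-bounds 1F (s≤s z≤n) (+-mono-≤ 1≤y (m≤m+n z _)))
  ( 1
  , parks ≤-refl (s≤s (m≤m+n y _)) (λ _ ()) (λ l u → contradiction l (<⇒≱ u))
  , suc z
  , parks ≤-refl
      (s≤s (≤-reflexive z+z≡m))
      (λ { (l , _) (inj₂ (_ , u)) → <⇒≱ u (≤-trans (s≤s (m≤m+n y _)) l) ; _ (inj₁ ()) })
      (λ l u → contradiction l (<⇒≱ u))
  -- Here `b` is `suc y`, and `b + sum ys` is `suc z`, the first spot of car 2: the remaining cars
  -- fill precisely the space between cars 1 and 2.
  , allPark-contiguous ys≢0 (early-≤ ys (replicate-1-bounds n (s≤s z≤n)))
      (s≤s (+-monoʳ-≤ y (m≤n+m _ z)))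
      (λ l u → inj₁ (inj₂ (l , u)))
      (λ { l _ (inj₁ (inj₂ (_ , u))) → <⇒≱ u l
         ; _ u (inj₂ (l , _)) → <⇒≱ u l
         ; _ _ (inj₁ (inj₁ ())) }) )
  where
  z : ℕ
  z = y + sum ys
  1≤y : 1 ≤ y
  1≤y = >-nonZero⁻¹ y {{y≢0}}
  z+z≡m : z + z ≡ y + (z + sum ys)
  z+z≡m = trans (+-assoc y _ z) (cong (y +_) (+-comm _ z))

-- When a later car holds the entry `suc g`, car 1 already covers the spots up to `y`, and
-- `suc g ≤ suc y` leaves no room for a gap.
gapOfFitting-invariant : ∀ {ys : Vec ℕ n} → NonZero y → All NonZero ys → FirstFits g ys → g ≤ y →
  PAinv (y ∷ ys) (replicate (suc n) 1 [ zero ]≔ suc g)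
gapOfFitting-invariant {y = y} {g = g} {ys = ys} y≢0 ys≢0 fit g≤y = update-invariant zero λ where
  zero    → PA-gapBeforeFirst y≢0 ys≢0 fit
  (suc i) → PA-contiguous (y ∷ ys) _ (y≢0 ∷ ys≢0)
    ((≤-refl , ≤-refl) , early-≤ ys (update-1-bounds i (s≤s z≤n) (s≤s g≤y)))
    (update-1-bounds (suc i) (s≤s z≤n) (+-mono-≤ (>-nonZero⁻¹ y {{y≢0}}) (firstFits⇒≤sum fit)))

gapOfSecond-invariant : ∀ {z} {ys : Vec ℕ n} → All NonZero (y ∷ z ∷ ys) → z ≡ y + sum ys →
  PAinv (y ∷ z ∷ ys) (replicate (suc (suc n)) 1 [ zero ]≔ suc z)
gapOfSecond-invariant {y = y} {ys = ys} nz@(y≢0 ∷ z≢0 ∷ ys≢0) refl = update-invariant zero λ where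
  zero          → PA-gapBeforeFirst y≢0 (z≢0 ∷ ys≢0) here
  1F            → PA-gapAfterFirst ys≢0 y≢0
  -- From car 3 on, the first two cars already cover `y + z` spots, so the preference `suc z` does
  -- not pass the next free spot.
  (suc (suc i)) → PA-contiguous (y ∷ _ ∷ ys) _ nz
    ( (≤-refl , ≤-refl) , (≤-refl , s≤s z≤n)
    , early-≤ ys (update-1-bounds i (s≤s z≤n) (s≤s (m≤n+m (y + sum ys) y))) )
    (update-1-bounds (suc (suc i)) (s≤s z≤n) (+-mono-≤ (>-nonZero⁻¹ y {{y≢0}}) (m≤m+n (y + sum ys) _)))

minimallyInvariant⇒¬gap : ∀ {ys : Vec ℕ (suc n)} → MinimallyInvariant ys → NonZero g →
  ¬ PAinv ys (replicate (suc n) 1 [ zero ]≔ suc g)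
minimallyInvariant⇒¬gap {g = suc _} (inv⇒1 , _) _ inv with () ← cong head (inv⇒1 inv)

theorem1 : ∀ {n : ℕ} (y : Vec ℕ (suc (suc n))) →
    All NonZero y →
    MinimallyInvariant y →
    head y < foldr₁ _⊓_ (tail y) × lookup y 1F ≢ sum (removeAt y 1F)
theorem1 (y ∷ ys@(z ∷ _)) nz@(y≢0 ∷ ys≢0@(z≢0 ∷ _)) minimal =
  ≰⇒> (λ μ≤y → minimallyInvariant⇒¬gap minimal (firstFits⇒nonZero ys≢0 (firstFits-min ys))
    (gapOfFitting-invariant y≢0 ys≢0 (firstFits-min ys) μ≤y)) ,
  λ z≡ → minimallyInvariant⇒¬gap minimal z≢0 (gapOfSecond-invariant nz z≡)
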